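{- Let $f(x)\in\mathbb{Z}[x]$ be monic with $\deg f(x)=n<m$, where $m$ is a positive integer, and let $q_1,\dots,q_m\in\mathbb{Z}$. Then the equation $$(y+q_1)(y+q_2)\cdots(y+q_m)=f(x)$$ has finitely many solutions $(x,y)$ in integers if and only if $|x-y|$ is bounded for all integer solutions $(x,y)$, i.e. there is a constant $C$ such that $|x-y|\le C$ for every integer solution $(x,y)$ of the equation. -}

module Defs where

open import Data.Integer using (ℤ; 0ℤ; 1ℤ; _+_; _*_)
open import Data.List using (List; []; _∷_)
open import Data.List.Membership.Propositional using (_∈_)
open import Data.Nat using (ℕ; zero; suc; _<_)
open import Data.Product using (∃; _×_; _,_)
open import Data.Vec.Functional using (Vector; foldr)
open import Function.Bundles using (_⇔_)
open import Level using (Level; _⊔_)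
open import Relation.Binary.PropositionalEquality using (_≡_; _≢_)
open import Relation.Unary using (Pred)

-- ℤ[x] as coefficient lists, constant term first.  Trailing zeros are
-- permitted, so the degree is read off the coefficients, not the length.
Poly : Set
Poly = List ℤ

coeff : Poly → ℕ → ℤ
coeff []      _       = 0ℤ
coeff (a ∷ f) zero    = a
coeff (a ∷ f) (suc k) = coeff f k

eval : Poly → ℤ → ℤ
eval []      x = 0ℤ
eval (a ∷ f) x = a + x * eval f x

-- No d satisfies this for the zero polynomial.
HasDegree : Poly → ℕ → Set
HasDegree f d = coeff f d ≢ 0ℤ × (∀ k → d < k → coeff f k ≡ 0ℤ)

Monic : Poly → Set
Monic f = ∃ λ d → HasDegree f d × coeff f d ≡ 1ℤ

∏ : ∀ {m} → Vector ℤ m → ℤ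
∏ = foldr _*_ 1ℤ

Solution : ∀ {m} → Vector ℤ m → Poly → Pred (ℤ × ℤ) _
Solution q f (x , y) = ∏ (λ i → y + q i) ≡ eval f x

-- The list may contain repetitions.
Finite : ∀ {a ℓ : Level} {A : Set a} → Pred A ℓ → Set (a ⊔ ℓ)
Finite {A = A} P = ∃ λ (xs : List A) → ∀ p → P p ⇔ p ∈ xs

-- If |x − y| ≤ C and |qᵢ| ≤ Q for all i, put t = |y| ∸ Q.  Each factor y + qᵢ has absolute
-- value at least t, whereas |x| < t + (1 + Q + C), so tᵐ ≤ S (t + 1 + Q + C)ⁿ with S the sum
-- of the absolute values of the coefficients of f.  Since n < m this bounds t, hence y and x.

{-# OPTIONS --safe #-}
module Submission where

open import Defs
open import Data.Integer using (ℤ; 0ℤ; -[1+_]; -_; ∣_∣; _-_)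
import Data.Integer as ℤ
import Data.Integer.Properties as ℤ
open import Data.Integer.Tactic.RingSolver using (solve-∀)
open import Data.Fin using (zero; suc)
open import Data.List using (List; []; _∷_; _++_; map; filter; tabulate; upTo; cartesianProduct)
open import Data.List.Extrema.Nat using (max; xs≤max)
open import Data.List.Membership.Propositional using (_∈_)
open import Data.List.Membership.Propositional.Properties
  using (∈-map⁺; ∈-++⁺ˡ; ∈-++⁺ʳ; ∈-upTo⁺; ∈-filter⁺; ∈-filter⁻; ∈-cartesianProduct⁺; ∈-tabulate⁺)
import Data.List.Relation.Unary.All as All
open import Data.Nat using (ℕ; zero; suc; _+_; _*_; _^_; _∸_; _<_; _≤_; z≤n; s≤s; NonZero; >-nonZero)
open import Data.Nat.Properties
open import Data.Product using (∃; _×_; _,_; proj₁; proj₂)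
open import Data.Vec.Functional using (Vector)
open import Function using (_∘_)
open import Function.Bundles using (_⇔_; mk⇔; Equivalence)
open import Relation.Binary.PropositionalEquality using (_≡_; refl; trans; cong)
open import Relation.Nullary using (yes; no)
open import Relation.Unary using (Pred; Decidable)
open import Algebra.Properties.CommutativeSemigroup *-commutativeSemigroup using (x∙yz≈y∙xz)

open ≤-Reasoning

∣i∣≤∣j∣+∣i-j∣ : ∀ i j → ∣ i ∣ ≤ ∣ j ∣ + ∣ i - j ∣
∣i∣≤∣j∣+∣i-j∣ i j = begin
  ∣ i ∣                ≡⟨ cong ∣_∣ (split i j) ⟩
  ∣ j ℤ.+ (i - j) ∣    ≤⟨ ℤ.∣i+j∣≤∣i∣+∣j∣ j (i - j) ⟩
  ∣ j ∣ + ∣ i - j ∣    ∎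
  where
  split : ∀ i j → i ≡ j ℤ.+ (i - j)
  split = solve-∀

∣i∣≤∣j∣+∣i+j∣ : ∀ i j → ∣ i ∣ ≤ ∣ j ∣ + ∣ i ℤ.+ j ∣
∣i∣≤∣j∣+∣i+j∣ i j = begin
  ∣ i ∣                    ≤⟨ ∣i∣≤∣j∣+∣i-j∣ i (- j) ⟩
  ∣ - j ∣ + ∣ i - - j ∣    ≡⟨ cong (λ k → ∣ - j ∣ + ∣ i ℤ.+ k ∣) (ℤ.neg-involutive j) ⟩
  ∣ - j ∣ + ∣ i ℤ.+ j ∣    ≡⟨ cong (_+ ∣ i ℤ.+ j ∣) (ℤ.∣-i∣≡∣i∣ j) ⟩
  ∣ j ∣ + ∣ i ℤ.+ j ∣      ∎

∈⇒≤max : ∀ {x} {xs : List ℕ} → x ∈ xs → x ≤ max 0 xs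
∈⇒≤max {xs = xs} = All.lookup (xs≤max 0 xs)

-- Zero is listed in both halves, which is harmless because `Finite` allows repetitions.
interval : ℕ → List ℤ
interval B = map ℤ.+_ (upTo (suc B)) ++ map (λ k → - ℤ.+ k) (upTo (suc B))

∈-interval : ∀ {B} i → ∣ i ∣ ≤ B → i ∈ interval B
∈-interval (ℤ.+ k)      k≤B = ∈-++⁺ˡ (∈-map⁺ ℤ.+_ (∈-upTo⁺ (s≤s k≤B)))
∈-interval {B} -[1+ k ] k<B =
  ∈-++⁺ʳ (map ℤ.+_ (upTo (suc B))) (∈-map⁺ (λ k → - ℤ.+ k) (∈-upTo⁺ (s≤s k<B)))

-- The bounds confine `P` to a finite box; decidability lets exactly the members of `P` be filtered
-- out of it.
bounded⇒finite : ∀ {ℓ} {P : Pred (ℤ × ℤ) ℓ} → Decidable P → ∀ A B →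
  (∀ x y → P (x , y) → ∣ x ∣ ≤ A × ∣ y ∣ ≤ B) → Finite P
bounded⇒finite P? A B bound = filter P? box , λ (x , y) → mk⇔
  (λ p → let x≤A , y≤B = bound x y p in
    ∈-filter⁺ P? (∈-cartesianProduct⁺ (∈-interval x x≤A) (∈-interval y y≤B)) p)
  (proj₂ ∘ ∈-filter⁻ P? {xs = box})
  where box = cartesianProduct (interval A) (interval B)

solution? : ∀ {m} (q : Vector ℤ m) f → Decidable (Solution q f)
solution? q f (x , y) = ∏ (λ i → y ℤ.+ q i) ℤ.≟ eval f x

^≤∣∏∣ : ∀ {m t} (r : Vector ℤ m) → (∀ i → t ≤ ∣ r i ∣) → t ^ m ≤ ∣ ∏ r ∣
^≤∣∏∣ {zero}      r t≤r = ≤-refl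
^≤∣∏∣ {suc m} {t} r t≤r = begin
  t * t ^ m                          ≤⟨ *-mono-≤ (t≤r zero) (^≤∣∏∣ (r ∘ suc) (t≤r ∘ suc)) ⟩
  ∣ r zero ∣ * ∣ ∏ (r ∘ suc) ∣       ≡⟨ ℤ.abs-* (r zero) (∏ (r ∘ suc)) ⟨
  ∣ ∏ r ∣                            ∎

-- The ℓ¹ norm of the coefficients, not the maximum that the word often denotes; being additive
-- along `∷`, it suits Horner induction.
height : Poly → ℕ
height []      = 0
height (a ∷ f) = ∣ a ∣ + height f

coeff≡0⇒eval≡0 : ∀ f x → (∀ k → coeff f k ≡ 0ℤ) → eval f x ≡ 0ℤ
coeff≡0⇒eval≡0 []      x f≡0 = refl
coeff≡0⇒eval≡0 (a ∷ f) x f≡0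
  rewrite f≡0 0 | coeff≡0⇒eval≡0 f x (f≡0 ∘ suc) | ℤ.*-zeroʳ x = refl

-- Induction along Horner's scheme, the tail having a degree bound one lower. The base `suc ∣ x ∣`
-- is at least 1 even for `x` zero, so its powers absorb the constant term.
∣eval∣≤ : ∀ n f x → (∀ k → n < k → coeff f k ≡ 0ℤ) → ∣ eval f x ∣ ≤ height f * suc ∣ x ∣ ^ n
∣eval∣≤ n       []      x f≡0 = z≤n
-- The tail may be nonempty, but it consists of trailing zeros and evaluates to 0.
∣eval∣≤ zero    (a ∷ f) x f≡0
  rewrite coeff≡0⇒eval≡0 f x (λ k → f≡0 (suc k) (s≤s z≤n)) | ℤ.*-zeroʳ x | ℤ.+-identityʳ a
        | *-identityʳ (∣ a ∣ + height f) = m≤m+n ∣ a ∣ (height f)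
∣eval∣≤ (suc n) (a ∷ f) x f≡0 = begin
  ∣ a ℤ.+ x ℤ.* eval f x ∣               ≤⟨ ℤ.∣i+j∣≤∣i∣+∣j∣ a (x ℤ.* eval f x) ⟩
  ∣ a ∣ + ∣ x ℤ.* eval f x ∣             ≡⟨ cong (∣ a ∣ +_) (ℤ.abs-* x (eval f x)) ⟩
  ∣ a ∣ + ∣ x ∣ * ∣ eval f x ∣           ≤⟨ +-mono-≤ (m≤m*n ∣ a ∣ (X ^ suc n) {{m^n≢0 X (suc n)}})
                                              (*-mono-≤ (n≤1+n ∣ x ∣)
                                                (∣eval∣≤ n f x (λ k → f≡0 (suc k) ∘ s≤s))) ⟩
  ∣ a ∣ * X ^ suc n + X * (height f * X ^ n)
    ≡⟨ cong (∣ a ∣ * X ^ suc n +_) (x∙yz≈y∙xz X (height f) (X ^ n)) ⟩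
  ∣ a ∣ * X ^ suc n + height f * X ^ suc n
    ≡⟨ *-distribʳ-+ (X ^ suc n) ∣ a ∣ (height f) ⟨
  height (a ∷ f) * X ^ suc n             ∎
  where X = suc ∣ x ∣

^-distribʳ-* : ∀ n a b → (a * b) ^ n ≡ a ^ n * b ^ n
^-distribʳ-* zero    a b = refl
^-distribʳ-* (suc n) a b =
  trans (cong (a * b *_) (^-distribʳ-* n a b)) ([m*n]*[o*p]≡[m*o]*[n*p] a b (a ^ n) (b ^ n))

-- If `t` exceeds `K`, then `t + K ≤ 2 * t`, and the positive factor `t ^ n` cancels to leave
-- `t ≤ S * 2 ^ n`. Adding the bounds of the two cases covers both.
^≤*^⇒≤ : ∀ {m n} S K t → n < m → t ^ m ≤ S * (t + K) ^ n → t ≤ K + S * 2 ^ n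
^≤*^⇒≤ {m} {n} S K t n<m tᵐ≤ with t ≤? K
... | yes t≤K = m≤n⇒m≤n+o (S * 2 ^ n) t≤K
... | no  t≰K = m≤n⇒m≤o+n K (*-cancelʳ-≤ t (S * 2 ^ n) (t ^ n) {{m^n≢0 t n}} (begin
  t * t ^ n              ≤⟨ ^-monoʳ-≤ t n<m ⟩
  t ^ m                  ≤⟨ tᵐ≤ ⟩
  -- The product `2 * t` unfolds to `t + (t + 0)`, hence the summand 0.
  S * (t + K) ^ n        ≤⟨ *-monoʳ-≤ S (^-monoˡ-≤ n (+-monoʳ-≤ t (m≤n⇒m≤n+o 0 (<⇒≤ K<t)))) ⟩
  S * (2 * t) ^ n        ≡⟨ cong (S *_) (^-distribʳ-* n 2 t) ⟩
  S * (2 ^ n * t ^ n)    ≡⟨ *-assoc S (2 ^ n) (t ^ n) ⟨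
  S * 2 ^ n * t ^ n      ∎))
  where
  K<t = ≰⇒> t≰K
  instance
    t≢0 : NonZero t
    t≢0 = >-nonZero (≤-<-trans z≤n K<t)

finite⇒bounded : ∀ {ℓ} {P : Pred (ℤ × ℤ) ℓ} → Finite P →
  ∃ λ (C : ℕ) → ∀ x y → P (x , y) → ∣ x - y ∣ ≤ C
finite⇒bounded (xs , P⇔∈) =
  -- The default 0 is the bound when there are no solutions.
  max 0 (map dist xs) , λ x y p → ∈⇒≤max (∈-map⁺ dist (Equivalence.to (P⇔∈ (x , y)) p))
  where
  dist : ℤ × ℤ → ℕ
  dist (x , y) = ∣ x - y ∣

solution-bound : ∀ {m n} f → (∀ k → n < k → coeff f k ≡ 0ℤ) → n < m → (q : Vector ℤ m) →
  ∀ C → ∃ λ B → ∀ x y → Solution q f (x , y) → ∣ x - y ∣ ≤ C → ∣ y ∣ ≤ B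
solution-bound {m} {n} f f≡0 n<m q C = Q + (K + height f * 2 ^ n) , bound
  where
  Q = max 0 (tabulate (∣_∣ ∘ q))
  -- Chosen for `x<t+K`: `∣ x ∣` is at most `Q + t + C`, and the `suc` matches the base `suc ∣ x ∣`
  -- in `∣eval∣≤`.
  K = suc (Q + C)

  bound : ∀ x y → Solution q f (x , y) → ∣ x - y ∣ ≤ C → ∣ y ∣ ≤ Q + (K + height f * 2 ^ n)
  bound x y sol x-y≤C = begin
    ∣ y ∣                            ≤⟨ m≤n+m∸n ∣ y ∣ Q ⟩
    Q + t                            ≤⟨ +-monoʳ-≤ Q (^≤*^⇒≤ (height f) K t n<m tᵐ≤) ⟩
    Q + (K + height f * 2 ^ n)       ∎
    where
    -- Truncated subtraction gives 0 when `∣ y ∣ ≤ Q`, so small `y` need no separate case.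
    t = ∣ y ∣ ∸ Q

    t≤ : ∀ i → t ≤ ∣ y ℤ.+ q i ∣
    t≤ i = m≤n+o⇒m∸n≤o ∣ y ∣ Q (begin
      ∣ y ∣                       ≤⟨ ∣i∣≤∣j∣+∣i+j∣ y (q i) ⟩
      ∣ q i ∣ + ∣ y ℤ.+ q i ∣     ≤⟨ +-monoˡ-≤ _ (∈⇒≤max (∈-tabulate⁺ i)) ⟩
      Q + ∣ y ℤ.+ q i ∣           ∎)

    x<t+K : suc ∣ x ∣ ≤ t + K
    x<t+K = begin
      suc ∣ x ∣                   ≤⟨ s≤s (∣i∣≤∣j∣+∣i-j∣ x y) ⟩
      suc (∣ y ∣ + ∣ x - y ∣)     ≤⟨ s≤s (+-mono-≤ (m≤n+m∸n ∣ y ∣ Q) x-y≤C) ⟩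
      suc (Q + t + C)             ≡⟨ cong (λ s → suc (s + C)) (+-comm Q t) ⟩
      suc (t + Q + C)             ≡⟨ cong suc (+-assoc t Q C) ⟩
      suc (t + (Q + C))           ≡⟨ +-suc t (Q + C) ⟨
      t + K                       ∎

    tᵐ≤ : t ^ m ≤ height f * (t + K) ^ n
    tᵐ≤ = begin
      t ^ m                           ≤⟨ ^≤∣∏∣ (λ i → y ℤ.+ q i) t≤ ⟩
      ∣ ∏ (λ i → y ℤ.+ q i) ∣         ≡⟨ cong ∣_∣ sol ⟩
      ∣ eval f x ∣                    ≤⟨ ∣eval∣≤ n f x f≡0 ⟩
      height f * suc ∣ x ∣ ^ n        ≤⟨ *-monoʳ-≤ (height f) (^-monoˡ-≤ n x<t+K) ⟩
      height f * (t + K) ^ n          ∎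

theorem1p3 : (m n : ℕ) .{{_ : NonZero m}} (f : Poly) →
    Monic f → HasDegree f n → n < m →
    (q : Vector ℤ m) →
    Finite (Solution q f) ⇔ (∃ λ (C : ℕ) → ∀ x y → Solution q f (x , y) → ∣ x - y ∣ ≤ C)
theorem1p3 m n f _ (_ , f≡0) n<m q = mk⇔ finite⇒bounded λ (C , x-y≤C) →
  let B , y≤B = solution-bound f f≡0 n<m q C in
  bounded⇒finite (solution? q f) (B + C) B λ x y sol →
    let ∣y∣≤B = y≤B x y sol (x-y≤C x y sol) in
    ≤-trans (∣i∣≤∣j∣+∣i-j∣ x y) (+-mono-≤ ∣y∣≤B (x-y≤C x y sol)) , ∣y∣≤B
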